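{- Let $L$ be a (classical first-order) signature and let $T$ be a consistent $L$-theory. Then $T$ is preserved under reduced products, reduced roots and (finite) cartesian factors if and only if $T$ is axiomatizable by a set of Palyutin sentences. (The equivalence holds both with "cartesian factors" and with "finite cartesian factors".)
   Context: Classical first-order logic with equality; structures are nonempty. All filters are proper filters on (nonempty) sets. Reduced products: for a family $(M_i)_{i\in I}$ of $L$-structures and a filter $F$ on $I$, let $a\sim_F b$ on $\prod_i M_i$ iff $\{i : a_i=b_i\}\in F$. The reduced product $\prod_i M_i/F$ has domain $\prod_i M_i/\sim_F$; a relation $R$ holds of the class of $(a_i)_i$ iff $\{i : M_i\models R(a_i)\}\in F$, and functions (and constants) are interpreted coordinatewise. If all $M_i=N$, this is the reduced power $N^F$. A theory $T$ is: preserved under reduced products if for every family $(M_i)_{i\in I}$ and filter $F$ on $I$ with $\{i: M_i\models T\}\in F$, we have $\prod_i M_i/F\models T$; preserved under reduced roots if for every $M$ and every filter $F$ with $M^F\models T$, we have $M\models T$; preserved under (finite) cartesian factors if for every (finite) family $(M_i)_{i\in I}$ with $\prod_i M_i\models T$, we have $M_i\models T$ for every $i$. Palyutin formulas: the smallest set of first-order formulas such that (1) it contains $\top$, $\bot$ and all atomic formulas; (2) it is closed under conjunction, $\exists$ and $\forall$; (3) if $\varphi,\psi$ are Palyutin formulas and $x$ is any variable, then $(\exists x\,\varphi) \wedge \forall x\,(\varphi \rightarrow \psi)$ is a Palyutin formula. A Palyutin sentence is a Palyutin formula with no free variables. -}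

module Defs where

open import Data.Fin.Base using (Fin; zero; suc)
open import Data.Nat.Base using (ℕ; zero; suc)
open import Data.Product.Base using (Σ-syntax; _×_; _,_)
open import Data.Sum.Base using (_⊎_)
import Data.Empty.Polymorphic as Empty
import Data.Unit.Polymorphic as Unit
open import Data.Vec.Functional using (Vector; _∷_; [])
open import Function.Base using (_∘_; const)
open import Function.Bundles using (_↔_; _⇔_)
open import Level using (Level) renaming (suc to lsuc)
open import Relation.Binary.Bundles using (Setoid)
open import Relation.Nullary.Negation.Core using (¬_)
open import Relation.Unary using (Pred; _∈_; _⊆_; _∩_)
import Relation.Unary.Polymorphic as Poly

private
  variable
    ℓ : Level
    n : ℕ

-- Symbols of arity 0 are allowed; constants are function symbols of arity 0.

record Signature (ℓ : Level) : Set (lsuc ℓ) where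
  field
    Fun      : Set ℓ
    Rel      : Set ℓ
    funArity : Fun → ℕ
    relArity : Rel → ℕ

open Signature public

-- Well-scoped de Bruijn syntax: the free variables of a term or formula of
-- index n are among 0, …, n - 1, and a quantifier binds variable 0 of its body.

data Term (L : Signature ℓ) (n : ℕ) : Set ℓ where
  var : Fin n → Term L n
  fun : (f : Fun L) → Vector (Term L n) (funArity L f) → Term L n

infix  9 _≐_
infixr 8 _∧′_
infixr 7 _∨′_
infixr 6 _⇒′_

-- Negation ¬ φ is φ ⇒′ ⊥′.

data Formula (L : Signature ℓ) : ℕ → Set ℓ where
  ⊤′ ⊥′          : Formula L n
  _≐_            : Term L n → Term L n → Formula L n
  rel            : (R : Rel L) → Vector (Term L n) (relArity L R) → Formula L n
  _∧′_ _∨′_ _⇒′_ : Formula L n → Formula L n → Formula L n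
  ∃′ ∀′          : Formula L (suc n) → Formula L n

Sentence : Signature ℓ → Set ℓ
Sentence L = Formula L 0

Theory : Signature ℓ → Set (lsuc ℓ)
Theory {ℓ} L = Pred (Sentence L) ℓ

-- A structure is carried by a setoid whose equality interprets ≐, so that the
-- quotient of a product by ∼_F is again a structure.

record Structure (L : Signature ℓ) : Set (lsuc ℓ) where
  field
    setoid : Setoid ℓ ℓ

  open Setoid setoid public

  field
    nonempty : Carrier
    funⁱ     : (f : Fun L) → Vector Carrier (funArity L f) → Carrier
    relⁱ     : (R : Rel L) → Pred (Vector Carrier (relArity L R)) ℓ
    fun-cong : ∀ f {as bs} → (∀ k → as k ≈ bs k) → funⁱ f as ≈ funⁱ f bs
    rel-resp : ∀ R {as bs} → (∀ k → as k ≈ bs k) → relⁱ R as → relⁱ R bs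

module _ {L : Signature ℓ} (M : Structure L) where
  open Structure M

  eval : Vector Carrier n → Term L n → Carrier
  eval ρ (var x)    = ρ x
  eval ρ (fun f ts) = funⁱ f (λ k → eval ρ (ts k))

  Sat : Vector Carrier n → Formula L n → Set ℓ
  Sat ρ ⊤′         = Unit.⊤
  Sat ρ ⊥′         = Empty.⊥
  Sat ρ (s ≐ t)    = eval ρ s ≈ eval ρ t
  Sat ρ (rel R ts) = relⁱ R (λ k → eval ρ (ts k))
  Sat ρ (φ ∧′ ψ)   = Sat ρ φ × Sat ρ ψ
  Sat ρ (φ ∨′ ψ)   = Sat ρ φ ⊎ Sat ρ ψ
  Sat ρ (φ ⇒′ ψ)   = Sat ρ φ → Sat ρ ψ
  Sat ρ (∃′ φ)     = Σ[ a ∈ Carrier ] Sat (a ∷ ρ) φ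
  Sat ρ (∀′ φ)     = (a : Carrier) → Sat (a ∷ ρ) φ

infix 4 _⊨_

_⊨_ : {L : Signature ℓ} → Structure L → Theory L → Set ℓ
M ⊨ T = ∀ φ → φ ∈ T → Sat M [] φ

Consistent : {L : Signature ℓ} → Theory L → Set (lsuc ℓ)
Consistent {L = L} T = Σ[ M ∈ Structure L ] M ⊨ T

-- Properness forces I to be nonempty.

record Filter (I : Set ℓ) : Set (lsuc ℓ) where
  field
    Mem    : Pred (Pred I ℓ) ℓ
    full   : Mem Poly.U
    upward : ∀ {P Q} → P ⊆ Q → Mem P → Mem Q
    inter  : ∀ {P Q} → Mem P → Mem Q → Mem (P ∩ Q)
    proper : ¬ Mem Poly.∅

  ⋂-mem : ∀ n {P : Fin n → Pred I ℓ} → (∀ k → Mem (P k)) → Mem (λ i → ∀ k → P k i)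
  ⋂-mem zero    _ = upward (λ _ ()) full
  ⋂-mem (suc n) p =
    upward (λ { (h , t) zero → h ; (h , t) (suc k) → t k })
           (inter (p zero) (⋂-mem n (p ∘ suc)))

module _ {L : Signature ℓ} {I : Set ℓ} where
  open Structure

  reducedProduct : (I → Structure L) → Filter I → Structure L
  reducedProduct M F = record
    { setoid = record
      { Carrier       = ∀ i → Carrier (M i)
      ; _≈_           = λ a b → Mem (λ i → _≈_ (M i) (a i) (b i))
      ; isEquivalence = record
        { refl  = upward (λ {i} _ → refl (M i)) full
        ; sym   = upward (λ {i} → sym (M i))
        ; trans = λ p q → upward (λ {i} (x , y) → trans (M i) x y) (inter p q)
        }
      }
    ; nonempty = λ i → nonempty (M i)
    ; funⁱ     = λ f as i → funⁱ (M i) f (λ k → as k i)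
    ; relⁱ     = λ R as → Mem (λ i → relⁱ (M i) R (λ k → as k i))
    ; fun-cong = λ f p → upward (λ {i} → fun-cong (M i) f) (⋂-mem _ p)
    ; rel-resp = λ R p r →
        upward (λ {i} (e , x) → rel-resp (M i) R e x) (inter (⋂-mem _ p) r)
    }
    where open Filter F

  reducedPower : Structure L → Filter I → Structure L
  reducedPower N F = reducedProduct (const N) F

  product : (I → Structure L) → Structure L
  product M = record
    { setoid = record
      { Carrier       = ∀ i → Carrier (M i)
      ; _≈_           = λ a b → ∀ i → _≈_ (M i) (a i) (b i)
      ; isEquivalence = record
        { refl  = λ i → refl (M i)
        ; sym   = λ p i → sym (M i) (p i)
        ; trans = λ p q i → trans (M i) (p i) (q i)
        }
      }
    ; nonempty = λ i → nonempty (M i)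
    ; funⁱ     = λ f as i → funⁱ (M i) f (λ k → as k i)
    ; relⁱ     = λ R as → ∀ i → relⁱ (M i) R (λ k → as k i)
    ; fun-cong = λ f p i → fun-cong (M i) f (λ k → p k i)
    ; rel-resp = λ R p r i → rel-resp (M i) R (λ k → p k i) (r i)
    }

Finite : Set ℓ → Set ℓ
Finite I = Σ[ n ∈ ℕ ] (I ↔ Fin n)

module _ {L : Signature ℓ} (T : Theory L) where

  PreservedUnderReducedProducts : Set (lsuc ℓ)
  PreservedUnderReducedProducts =
    (I : Set ℓ) (M : I → Structure L) (F : Filter I) →
    Filter.Mem F (λ i → M i ⊨ T) → reducedProduct M F ⊨ T

  PreservedUnderReducedRoots : Set (lsuc ℓ)
  PreservedUnderReducedRoots =
    (M : Structure L) (I : Set ℓ) (F : Filter I) →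
    reducedPower M F ⊨ T → M ⊨ T

  PreservedUnderCartesianFactors : Set (lsuc ℓ)
  PreservedUnderCartesianFactors =
    (I : Set ℓ) (M : I → Structure L) →
    product M ⊨ T → ∀ i → M i ⊨ T

  PreservedUnderFiniteCartesianFactors : Set (lsuc ℓ)
  PreservedUnderFiniteCartesianFactors =
    (I : Set ℓ) → Finite I → (M : I → Structure L) →
    product M ⊨ T → ∀ i → M i ⊨ T

data Palyutin {L : Signature ℓ} : Formula L n → Set ℓ where
  ⊤ᵖ   : Palyutin {n = n} ⊤′
  ⊥ᵖ   : Palyutin {n = n} ⊥′
  ≐ᵖ   : (s t : Term L n) → Palyutin (s ≐ t)
  relᵖ : (R : Rel L) (ts : Vector (Term L n) (relArity L R)) → Palyutin (rel R ts)
  ∧ᵖ   : {φ ψ : Formula L n} → Palyutin φ → Palyutin ψ → Palyutin (φ ∧′ ψ)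
  ∃ᵖ   : {φ : Formula L (suc n)} → Palyutin φ → Palyutin (∃′ φ)
  ∀ᵖ   : {φ : Formula L (suc n)} → Palyutin φ → Palyutin (∀′ φ)
  ∃∀ᵖ  : {φ ψ : Formula L (suc n)} → Palyutin φ → Palyutin ψ →
         Palyutin (∃′ φ ∧′ ∀′ (φ ⇒′ ψ))

PalyutinAxiomatizable : {L : Signature ℓ} → Theory L → Set (lsuc ℓ)
PalyutinAxiomatizable {L = L} T =
  Σ[ Γ ∈ Theory L ] (∀ φ → φ ∈ Γ → Palyutin φ) × (∀ M → M ⊨ T ⇔ M ⊨ Γ)

{-# OPTIONS --safe #-}

-- Palyutin formulas satisfy Łoś's theorem for arbitrary filters, which gives
-- the implication from right to left.  For the converse let F be the Fréchet
-- filter on ℕ.  As P(ℕ)/F is atomless, finitely many witnesses can be glued, so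
--   ∃y (θ ∧ ⋀ⱼ ¬ψⱼ)  ⇔  ∃y θ ∧ ⋀ⱼ ¬(∃y θ ∧ ∀y (θ → ψⱼ))
-- in every reduced product modulo F, for Palyutin θ and ψⱼ.  Hence every formula
-- is, uniformly in such reduced products, a Boolean combination of Palyutin
-- formulas, and structures with the same Palyutin theory have elementarily
-- equivalent reduced powers modulo F.  Now let N satisfy the Palyutin
-- consequences of T, and let M be the product of models of T refuting the
-- Palyutin sentences false in N.  Then M ⊨ T, and M and M × N have the same
-- Palyutin theory; so M^F ⊨ T gives (M × N)^F ⊨ T, M × N ⊨ T and N ⊨ T.

module Submission where

open import Defs
open import Axiom.ExcludedMiddle using (ExcludedMiddle)
open import Axiom.Extensionality.Propositional using (Extensionality)
open import Data.Bool.Base using (Bool; true; false; not; if_then_else_)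
open import Data.Bool.Properties using (¬-not; not-¬)
open import Data.Empty using (⊥-elim)
import Data.Empty.Polymorphic as Empty
open import Data.Fin.Base using (Fin; zero; suc)
open import Data.List.Base as List using (List; []; _∷_; _++_; cartesianProductWith)
open import Data.List.Relation.Unary.All as All using (All; []; _∷_)
import Data.List.Relation.Unary.All.Properties as All
open import Data.List.Relation.Unary.Any as Any using (Any; here; there)
import Data.List.Relation.Unary.Any.Properties as Any
open import Data.Nat.Base using (ℕ; zero; suc; _≤_; _≤′_; ≤′-refl; ≤′-step; _⊔_)
open import Data.Nat.Properties using (≤-refl; ≤-trans; m≤m⊔n; m≤n⊔m; ≤⇒≤′; ≤′⇒≤; n≤1+n)
open import Data.Product.Base using (Σ; Σ-syntax; ∃; ∃-syntax; _×_; _,_; proj₁; proj₂)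
open import Data.Sum.Base using (_⊎_; inj₁; inj₂; [_,_]′)
open import Data.Unit.Polymorphic using (tt)
open import Data.Vec.Functional using (Vector) renaming (_∷_ to _∷ᵛ_; [] to []ᵛ)
open import Function.Base using (_∘_; const; id; case_of_)
open import Function.Bundles using (_⇔_; mk⇔; mk↔ₛ′; Equivalence)
open import Function.Construct.Composition using (_⇔-∘_)
open import Function.Construct.Symmetry using (⇔-sym)
open import Level using (Level; Lift; lift; lower) renaming (suc to lsuc)
open import Relation.Binary.PropositionalEquality
  using (_≡_; refl; sym; trans; cong; cong₂; subst)
open import Relation.Nullary using (¬_; yes; no; does; contradiction)
open import Relation.Nullary.Decidable using (decidable-stable; True; toWitness; fromWitness)
open import Relation.Unary using (Pred; _⊆_; _∩_; ∁)
import Relation.Unary.Polymorphic as Poly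

open Equivalence using (to; from)
open Structure using (Carrier; nonempty)

private
  variable
    a ℓ : Level
    n : ℕ

module Classical (em : ∀ {a} → ExcludedMiddle a)
                 (ext : ∀ {a b} → Extensionality a b) where

  -- Classical choice and case distinction

  stable : {A : Set a} → ¬ ¬ A → A
  stable = decidable-stable em

  -- A `Theory` takes values in `Set ℓ`, but a quantifier over all structures does not. By excluded
  -- middle a proposition has a Boolean truth value, which fits in any universe.
  Resize : ∀ ℓ → Set a → Set ℓ
  Resize ℓ A = Lift ℓ (True (em {P = A}))

  resize : {A : Set a} → A → Resize ℓ A
  resize p = lift (fromWitness p)

  unresize : {A : Set a} → Resize ℓ A → A
  unresize p = toWitness (lower p)

  module _ {A : Set a} {ℓ} (P : Pred A ℓ) (d : A) where

    choose : A
    choose with em {P = ∃ P}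
    ... | yes (x , _) = x
    ... | no _        = d

    choose-spec : ∃ P → P choose
    choose-spec e with em {P = ∃ P}
    ... | yes (_ , p) = p
    ... | no ¬e       = contradiction e ¬e

    choose-elim : ∀ {q} {Q : Pred A q} → P ⊆ Q → Q d → Q choose
    choose-elim f q with em {P = ∃ P}
    ... | yes (_ , p) = f p
    ... | no _        = q

  ifᵈ : {A : Set a} → Set ℓ → A → A → A
  ifᵈ P x y = if does (em {P = P}) then x else y

  module _ {A : Set a} {P : Set ℓ} {x y : A} where

    ifᵈ-yes : P → ifᵈ P x y ≡ x
    ifᵈ-yes p with em {P = P}
    ... | yes _ = refl
    ... | no ¬p = contradiction p ¬p

    ifᵈ-no : ¬ P → ifᵈ P x y ≡ y
    ifᵈ-no ¬p with em {P = P}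
    ... | yes p = contradiction p ¬p
    ... | no _  = refl

  -- Łoś's theorem for Palyutin formulas

  module _ {L : Signature ℓ} {I : Set ℓ} (M : I → Structure L) (F : Filter I) where
    open Filter F

    private
      K : Structure L
      K = reducedProduct M F

    _at_ : Vector (Carrier K) n → ∀ i → Vector (Carrier (M i)) n
    (ρ at i) x = ρ x i

    ∷-at : (c : Carrier K) (ρ : Vector (Carrier K) n) →
           ∀ i → (c ∷ᵛ ρ) at i ≡ c i ∷ᵛ (ρ at i)
    ∷-at c ρ i = ext λ { zero → refl ; (suc _) → refl }

    eval-at : (ρ : Vector (Carrier K) n) (t : Term L n) →
              ∀ i → eval K ρ t i ≡ eval (M i) (ρ at i) t
    eval-at ρ (var x)    i = refl
    eval-at ρ (fun f ts) i = cong (Structure.funⁱ (M i) f) (ext λ k → eval-at ρ (ts k) i)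

    Sat∷ : Formula L (suc n) → Vector (Carrier K) n → ∀ i → Pred (Carrier (M i)) ℓ
    Sat∷ φ ρ i x = Sat (M i) (x ∷ᵛ (ρ at i)) φ

    mem-≡ : {P Q : Pred I ℓ} → (∀ i → P i ≡ Q i) → Mem P ⇔ Mem Q
    mem-≡ e = mk⇔ (upward λ {i} → subst id (e i))
                  (upward λ {i} → subst id (sym (e i)))

    -- A bare implication can fail to transfer along a filter. In `∃∀ᵖ` the conjunct `∃′ φ` provides
    -- witnesses of `φ` on a set in `F`, so the implication can be tested at a single element of
    -- `K`.
    Łoś : {φ : Formula L n} → Palyutin φ → (ρ : Vector (Carrier K) n) →
          Sat K ρ φ ⇔ Mem (λ i → Sat (M i) (ρ at i) φ)

    Łoś-∷ : {φ : Formula L (suc n)} → Palyutin φ →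
            (ρ : Vector (Carrier K) n) (c : Carrier K) →
            Sat K (c ∷ᵛ ρ) φ ⇔ Mem (λ i → Sat∷ φ ρ i (c i))
    Łoś-∷ {φ = φ} p ρ c =
      mem-≡ (λ i → cong (λ σ → Sat (M i) σ φ) (∷-at c ρ i)) ⇔-∘ Łoś p (c ∷ᵛ ρ)

    Łoś-∃ : {φ : Formula L (suc n)} → Palyutin φ → (ρ : Vector (Carrier K) n) →
            Sat K ρ (∃′ φ) ⇔ Mem (λ i → Sat (M i) (ρ at i) (∃′ φ))
    Łoś-∃ {φ = φ} p ρ = mk⇔
      (λ (c , s) → upward (λ {i} s → c i , s) (to (Łoś-∷ p ρ c) s))
      (λ m → c , from (Łoś-∷ p ρ c) (upward (λ {i} → choose-spec _ _) m))
      where c = λ i → choose (Sat∷ φ ρ i) (nonempty (M i))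

    Łoś ⊤ᵖ          ρ = mk⇔ (const (upward (const tt) full)) (const tt)
    Łoś ⊥ᵖ          ρ = mk⇔ (λ ()) (λ m → contradiction m proper)
    Łoś (≐ᵖ s t)    ρ =
      mem-≡ λ i → cong₂ (Structure._≈_ (M i)) (eval-at ρ s i) (eval-at ρ t i)
    Łoś (relᵖ R ts) ρ =
      mem-≡ λ i → cong (Structure.relⁱ (M i) R) (ext λ k → eval-at ρ (ts k) i)
    Łoś (∧ᵖ p q)    ρ = mk⇔
      (λ (s , t) → inter (to (Łoś p ρ) s) (to (Łoś q ρ) t))
      (λ m → from (Łoś p ρ) (upward proj₁ m) , from (Łoś q ρ) (upward proj₂ m))
    Łoś (∃ᵖ p)      ρ = Łoś-∃ p ρ
    Łoś (∀ᵖ {φ = φ} p) ρ = mk⇔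
      -- `c` picks a counterexample wherever there is one, so `φ` at `c i` gives `φ` throughout
      -- `M i`.
      (λ s → upward (λ {i} s x → stable λ ¬s → choose-spec (counter i) _ (x , ¬s) s)
                    (to (Łoś-∷ p ρ c) (s c)))
      (λ m x → from (Łoś-∷ p ρ x) (upward (λ {i} s → s (x i)) m))
      where
      counter = λ i → ∁ (Sat∷ φ ρ i)
      c       = λ i → choose (counter i) (nonempty (M i))
    Łoś (∃∀ᵖ {φ = φ} {ψ} p q) ρ = mk⇔
      (λ (e , s) → upward
        (λ {i} (e , t) → e , λ x u → stable λ ¬v →
          proj₂ (choose-spec (counter i) _ (x , u , ¬v)) t)
        (inter (to (Łoś-∃ p ρ) e)
          -- Where `φ` is satisfiable, the counterexample and the default value both satisfy it, so
          -- the implication applies to `c`.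
          (to (Łoś-∷ q ρ c) (s c (from (Łoś-∷ p ρ c)
            (upward (λ {i} e → choose-elim (counter i) _ proj₁ (choose-spec _ _ e))
                    (to (Łoś-∃ p ρ) e)))))))
      (λ m → from (Łoś-∃ p ρ) (upward proj₁ m) , λ x s →
        from (Łoś-∷ q ρ x) (upward (λ {i} ((_ , f) , s) → f (x i) s)
                                   (inter m (to (Łoś-∷ p ρ x) s))))
      where
      counter = λ i → Sat∷ φ ρ i ∩ ∁ (Sat∷ ψ ρ i)
      -- If φ → ψ fails at some x in M i, this picks such an x; otherwise it
      -- picks any witness of φ.
      c : Carrier K
      c i = choose (counter i) (choose (Sat∷ φ ρ i) (nonempty (M i)))

    Łoś-sentence : {φ : Sentence L} → Palyutin φ →
                   Sat K []ᵛ φ ⇔ Mem (λ i → Sat (M i) []ᵛ φ)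
    Łoś-sentence {φ} p =
      mem-≡ (λ i → cong (λ ρ → Sat (M i) ρ φ) (ext λ ())) ⇔-∘ Łoś p []ᵛ

  -- The set of coordinates where `φ` holds is all of `I` or empty, and a proper filter excludes the
  -- latter.
  Łoś-power : {L : Signature ℓ} (M : Structure L) {I : Set ℓ} (F : Filter I) →
              {φ : Sentence L} → Palyutin φ →
              Sat (reducedPower M F) []ᵛ φ ⇔ Sat M []ᵛ φ
  Łoś-power M F p = mk⇔
    (λ m → stable λ ¬s → proper (upward (⊥-elim ∘ ¬s) (to (Łoś-sentence (const M) F p) m)))
    (λ s → from (Łoś-sentence (const M) F p) (upward (const s) full))
    where open Filter F

  -- Cartesian products

  -- Only the whole index set is a member, so the reduced product is the cartesian product; the
  -- element `i` makes the filter proper.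
  trivialFilter : {I : Set ℓ} → I → Filter I
  trivialFilter i = record
    { Mem    = λ P → ∀ i → P i
    ; full   = λ _ → tt
    ; upward = λ f p i → f (p i)
    ; inter  = λ p q i → p i , q i
    ; proper = λ p → Empty.⊥-elim (p i)
    }

  -- product M and reducedProduct M (trivialFilter i) differ only in their
  -- congruence proofs, which satisfaction does not mention.
  module _ {L : Signature ℓ} {I : Set ℓ} (M : I → Structure L) (i : I) where

    private
      P Q : Structure L
      P = product M
      Q = reducedProduct M (trivialFilter i)
      module P = Structure P

    eval-product : (ρ : Vector P.Carrier n) (t : Term L n) → eval P ρ t ≡ eval Q ρ t
    eval-product ρ (var x)    = refl
    eval-product ρ (fun f ts) = cong (P.funⁱ f) (ext λ k → eval-product ρ (ts k))

    Sat-product : (ρ : Vector P.Carrier n) (φ : Formula L n) → Sat P ρ φ ≡ Sat Q ρ φ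
    Sat-product ρ ⊤′         = refl
    Sat-product ρ ⊥′         = refl
    Sat-product ρ (s ≐ t)    = cong₂ P._≈_ (eval-product ρ s) (eval-product ρ t)
    Sat-product ρ (rel R ts) = cong (P.relⁱ R) (ext λ k → eval-product ρ (ts k))
    Sat-product ρ (φ ∧′ ψ)   = cong₂ _×_ (Sat-product ρ φ) (Sat-product ρ ψ)
    Sat-product ρ (φ ∨′ ψ)   = cong₂ _⊎_ (Sat-product ρ φ) (Sat-product ρ ψ)
    Sat-product ρ (φ ⇒′ ψ)   = cong₂ (λ A B → A → B) (Sat-product ρ φ) (Sat-product ρ ψ)
    Sat-product ρ (∃′ φ)     = cong (Σ P.Carrier) (ext λ c → Sat-product (c ∷ᵛ ρ) φ)
    Sat-product ρ (∀′ φ)     =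
      cong (λ A → (c : P.Carrier) → A c) (ext λ c → Sat-product (c ∷ᵛ ρ) φ)

    product-⊨ : (T : Theory L) → product M ⊨ T ⇔ reducedProduct M (trivialFilter i) ⊨ T
    product-⊨ T = mk⇔ (λ s φ p → subst id (Sat-product []ᵛ φ) (s φ p))
                      (λ s φ p → subst id (sym (Sat-product []ᵛ φ)) (s φ p))

  -- Atomless filters

  module _ {I : Set ℓ} (F : Filter I) where
    open Filter F

    -- If `P` is not in the filter, then `∁ P` is positive, and `A` splits it into two positive
    -- parts: the algebra of subsets modulo `F` has no atoms.
    Atomless : Set (lsuc ℓ)
    Atomless = (P : Pred I ℓ) → ¬ Mem P →
      Σ[ A ∈ Pred I ℓ ] ¬ Mem (λ i → A i → P i) × ¬ Mem (λ i → ¬ A i → P i)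

    -- In terms of the positive sets ∁ Q and ∁ P: the set A contains a positive
    -- part of ∁ Q and misses a positive part of each ∁ P.
    separate : Atomless → ∀ Q → ¬ Mem Q → (Ps : List (Pred I ℓ)) → All (λ P → ¬ Mem P) Ps →
      Σ[ A ∈ Pred I ℓ ] ¬ Mem (λ i → A i → Q i) × All (λ P → ¬ Mem (λ i → ¬ A i → P i)) Ps
    separate atomless Q ¬q [] [] =
      Poly.U , (λ m → ¬q (upward (λ f → f tt) m)) , []
    separate atomless Q ¬q (P ∷ Ps) (¬p ∷ ¬ps)
      with A , ¬aq , ¬aps ← separate atomless Q ¬q Ps ¬ps
      -- `A ∩ B` and `A ∩ ∁ B` both keep a positive part of `∁ Q`. As they are disjoint, one of them
      -- misses a positive part of `∁ P`; shrinking `A` preserves what it already misses.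
      with B , ¬bq , ¬b′q ← atomless (λ i → A i → Q i) ¬aq
      with em {P = Mem (λ i → ¬ (A i × B i) → P i)}
    ... | no ¬m =
      A ∩ B , (λ m → ¬bq (upward (λ f b a → f (a , b)) m)) ,
      ¬m ∷ All.map (λ ¬m m → ¬m (upward (λ f ¬a → f (¬a ∘ proj₁)) m)) ¬aps
    ... | yes m =
      A ∩ ∁ B , (λ m → ¬b′q (upward (λ f b a → f (a , b)) m)) ,
      (λ m′ → ¬p (upward (λ {i} → merge i) (inter m m′))) ∷
      All.map (λ ¬m m → ¬m (upward (λ f ¬a → f (¬a ∘ proj₁)) m)) ¬aps
      where
      merge : ∀ i → (¬ (A i × B i) → P i) × (¬ (A i × ¬ B i) → P i) → P i
      merge i (f , g) with em {P = B i}
      ... | yes b = g λ (_ , ¬b) → ¬b b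
      ... | no ¬b = f λ (_ , b) → ¬b b

  -- Elimination of quantifiers

  module _ (L : Signature ℓ) where

    PalyutinFormula : ℕ → Set ℓ
    PalyutinFormula n = Σ (Formula L n) Palyutin

    -- A clause (θ , ψs) stands for θ ∧ ⋀ ¬ ψⱼ, and a list of clauses for the
    -- disjunction of its entries.
    Clause : ℕ → Set ℓ
    Clause n = PalyutinFormula n × List (PalyutinFormula n)

  module _ {L : Signature ℓ} where

    _∧ᶜ_ : Clause L n → Clause L n → Clause L n
    ((θ , p) , ψs) ∧ᶜ ((θ′ , p′) , ψs′) = (θ ∧′ θ′ , ∧ᵖ p p′) , ψs ++ ψs′

    -- The guard `∃′ θ` makes the negated formulas Palyutin. The positive part asserts it too, so
    -- each negation amounts to a witness of `θ` refuting `ψ`.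
    ∃ᶜ : Clause L (suc n) → Clause L n
    ∃ᶜ ((θ , p) , ψs) =
      (∃′ θ , ∃ᵖ p) , List.map (λ (ψ , q) → ∃′ θ ∧′ ∀′ (θ ⇒′ ψ) , ∃∀ᵖ p q) ψs

    ¬ᶜ : Clause L n → List (Clause L n)
    ¬ᶜ (θ , ψs) = ((⊤′ , ⊤ᵖ) , θ ∷ []) ∷ List.map (_, []) ψs

    ¬ᵈ : List (Clause L n) → List (Clause L n)
    ¬ᵈ []       = ((⊤′ , ⊤ᵖ) , []) ∷ []
    ¬ᵈ (C ∷ Cs) = cartesianProductWith _∧ᶜ_ (¬ᶜ C) (¬ᵈ Cs)

    -- Computed from the formula alone, so that the same Boolean combination serves different
    -- reduced products.
    normalForm : Formula L n → List (Clause L n)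
    normalForm ⊤′         = ((⊤′ , ⊤ᵖ) , []) ∷ []
    normalForm ⊥′         = []
    normalForm (s ≐ t)    = ((s ≐ t , ≐ᵖ s t) , []) ∷ []
    normalForm (rel R ts) = ((rel R ts , relᵖ R ts) , []) ∷ []
    normalForm (φ ∧′ ψ)   = cartesianProductWith _∧ᶜ_ (normalForm φ) (normalForm ψ)
    normalForm (φ ∨′ ψ)   = normalForm φ ++ normalForm ψ
    normalForm (φ ⇒′ ψ)   = ¬ᵈ (normalForm φ) ++ normalForm ψ
    normalForm (∃′ φ)     = List.map ∃ᶜ (normalForm φ)
    normalForm (∀′ φ)     = ¬ᵈ (List.map ∃ᶜ (¬ᵈ (normalForm φ)))

    module _ (K : Structure L) (ρ : Vector (Structure.Carrier K) n) where

      Satᶜ : Clause L n → Set ℓ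
      Satᶜ ((θ , _) , ψs) = Sat K ρ θ × All (λ (ψ , _) → ¬ Sat K ρ ψ) ψs

      Satᵈ : List (Clause L n) → Set ℓ
      Satᵈ = Any Satᶜ

      Sat-∧ᶜ : ∀ C D → Satᶜ (C ∧ᶜ D) ⇔ (Satᶜ C × Satᶜ D)
      Sat-∧ᶜ (_ , ψs) _ = mk⇔
        (λ ((s , t) , ss) → (s , All.++⁻ˡ ψs ss) , (t , All.++⁻ʳ ψs ss))
        (λ ((s , ss) , (t , ts)) → (s , t) , All.++⁺ ss ts)

      Sat-∧ᵈ : ∀ Cs Ds → Satᵈ (cartesianProductWith _∧ᶜ_ Cs Ds) ⇔ (Satᵈ Cs × Satᵈ Ds)
      Sat-∧ᵈ Cs Ds = mk⇔
        (Any.cartesianProductWith⁻ _∧ᶜ_ (λ {C} {D} → to (Sat-∧ᶜ C D)) Cs Ds)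
        (λ (s , t) → Any.cartesianProductWith⁺ _∧ᶜ_ (λ {C} {D} s t → from (Sat-∧ᶜ C D) (s , t)) s t)

      Sat-++ : ∀ Cs Ds → Satᵈ (Cs ++ Ds) ⇔ (Satᵈ Cs ⊎ Satᵈ Ds)
      Sat-++ Cs Ds = mk⇔ (Any.++⁻ Cs) [ Any.++⁺ˡ , Any.++⁺ʳ Cs ]′

      Sat-¬ᶜ : ∀ C → Satᵈ (¬ᶜ C) ⇔ (¬ Satᶜ C)
      Sat-¬ᶜ (θ , ψs) = mk⇔
        (λ { (here (_ , ¬t ∷ [])) (t , _)  → ¬t t
           ; (there s)            (_ , ss) →
               All.All¬⇒¬Any ss (Any.map proj₁ (Any.map⁻ s)) })
        backward
        where
        backward : ¬ Satᶜ (θ , ψs) → Satᵈ (¬ᶜ (θ , ψs))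
        backward ¬s with em {P = Sat K ρ (proj₁ θ)}
        ... | no ¬t = here (tt , ¬t ∷ [])
        ... | yes t = there (Any.map⁺ (Any.map (_, [])
                        (stable λ ¬any → ¬s (t , All.¬Any⇒All¬ ψs ¬any))))

      Sat-¬ᵈ : ∀ Cs → Satᵈ (¬ᵈ Cs) ⇔ (¬ Satᵈ Cs)
      Sat-¬ᵈ []       = mk⇔ (λ _ ()) (λ _ → here (tt , []))
      Sat-¬ᵈ (C ∷ Cs) = mk⇔
        (λ s → let t , u = to (Sat-∧ᵈ (¬ᶜ C) (¬ᵈ Cs)) s in
          λ { (here v) → to (Sat-¬ᶜ C) t v ; (there v) → to (Sat-¬ᵈ Cs) u v })
        (λ ¬s → from (Sat-∧ᵈ (¬ᶜ C) (¬ᵈ Cs))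
          (from (Sat-¬ᶜ C) (¬s ∘ here) , from (Sat-¬ᵈ Cs) (¬s ∘ there)))

    -- Quantifier elimination modulo an atomless filter

    module _ {I : Set ℓ} (F : Filter I) (atomless : Atomless F) (M : I → Structure L) where
      open Filter F

      private
        K : Structure L
        K = reducedProduct M F

      glue : (ρ : Vector (Carrier K) n)
             {θ : Formula L (suc n)} → Palyutin θ → (ψs : List (PalyutinFormula L (suc n))) →
             (∃[ y ] Sat K (y ∷ᵛ ρ) θ) →
             All (λ (ψ , _) → ∃[ y ] Sat K (y ∷ᵛ ρ) θ × ¬ Sat K (y ∷ᵛ ρ) ψ) ψs →
             ∃[ y ] Sat K (y ∷ᵛ ρ) θ × All (λ (ψ , _) → ¬ Sat K (y ∷ᵛ ρ) ψ) ψs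
      glue ρ p [] (y , s) [] = y , s , []
      glue ρ {θ} p ((ψ , q) ∷ ψs) e ((z , s , ¬t) ∷ es)
        with y , u , ¬vs ← glue ρ p ψs e es
        -- `w` will follow `z` on `A` and `y` off `A`. So `A` must keep a positive part of the
        -- failure of `ψ` at `z`, and its complement one of each later failure at `y`.
        with A , ¬az , ¬ay ← separate F atomless _ (¬t ∘ from (Łoś-∷ M F q ρ z))
               (List.map (λ (ψ , _) i → Sat∷ M F ψ ρ i (y i)) ψs)
               (All.map⁺ (All.map (λ { {ψ , q} ¬v → ¬v ∘ from (Łoś-∷ M F q ρ y) }) ¬vs))
        = w , from (Łoś-∷ M F p ρ w) (upward (λ {i} → w-θ i)
                (inter (to (Łoś-∷ M F p ρ z) s) (to (Łoś-∷ M F p ρ y) u))) ,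
          (λ v → ¬az (upward (λ {i} v a → subst (Sat∷ M F ψ ρ i) (ifᵈ-yes a) v)
                             (to (Łoś-∷ M F q ρ w) v))) ∷
          All.map (λ { {ψ , q} ¬m v → ¬m (upward (λ {i} v ¬a → subst (Sat∷ M F ψ ρ i) (ifᵈ-no ¬a) v)
                                                 (to (Łoś-∷ M F q ρ w) v)) })
                  (All.map⁻ ¬ay)
        where
        w : Carrier K
        w i = ifᵈ (A i) (z i) (y i)
        w-θ : ∀ i → Sat∷ M F θ ρ i (z i) × Sat∷ M F θ ρ i (y i) → Sat∷ M F θ ρ i (w i)
        w-θ i (s , u) with em {P = A i}
        ... | yes _ = s
        ... | no _  = u

      Sat-∃ᶜ : (ρ : Vector (Carrier K) n) (C : Clause L (suc n)) →
               Satᶜ K ρ (∃ᶜ C) ⇔ (∃[ y ] Satᶜ K (y ∷ᵛ ρ) C)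
      Sat-∃ᶜ ρ ((θ , p) , ψs) = mk⇔
        (λ (e , ¬s) → glue ρ p ψs e (All.map
          (λ ¬s → stable λ ¬e → ¬s (e , λ y t → stable λ ¬u → ¬e (y , t , ¬u)))
          (All.map⁻ ¬s)))
        (λ (y , t , ¬u) → (y , t) , All.map⁺ (All.map (λ ¬u (_ , f) → ¬u (f y t)) ¬u))

      Sat-∃ᵈ : (ρ : Vector (Carrier K) n) (Cs : List (Clause L (suc n))) →
               Satᵈ K ρ (List.map ∃ᶜ Cs) ⇔ (∃[ y ] Satᵈ K (y ∷ᵛ ρ) Cs)
      Sat-∃ᵈ ρ Cs = mk⇔
        (λ s → Any.Any-Σ⁻ʳ (Any.map (λ {C} → to (Sat-∃ᶜ ρ C)) (Any.map⁻ s)))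
        (λ e → Any.map⁺ (Any.map (λ {C} → from (Sat-∃ᶜ ρ C)) (Any.Any-Σ⁺ʳ e)))

      Sat-normalForm : (ρ : Vector (Carrier K) n) (φ : Formula L n) →
                       Sat K ρ φ ⇔ Satᵈ K ρ (normalForm φ)
      Sat-normalForm ρ ⊤′         = mk⇔ (λ s → here (s , [])) (const tt)
      Sat-normalForm ρ ⊥′         = mk⇔ (λ ()) (λ ())
      Sat-normalForm ρ (s ≐ t)    = mk⇔ (λ s → here (s , [])) (λ { (here (s , _)) → s })
      Sat-normalForm ρ (rel R ts) = mk⇔ (λ s → here (s , [])) (λ { (here (s , _)) → s })
      Sat-normalForm ρ (φ ∧′ ψ)   =
        let e = Sat-normalForm ρ φ ; f = Sat-normalForm ρ ψ
            g = Sat-∧ᵈ K ρ (normalForm φ) (normalForm ψ) in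
        mk⇔ (λ (s , t) → from g (to e s , to f t))
            (λ u → let s , t = to g u in from e s , from f t)
      Sat-normalForm ρ (φ ∨′ ψ)   =
        let e = Sat-normalForm ρ φ ; f = Sat-normalForm ρ ψ
            g = Sat-++ K ρ (normalForm φ) (normalForm ψ) in
        mk⇔ (λ { (inj₁ s) → from g (inj₁ (to e s)) ; (inj₂ t) → from g (inj₂ (to f t)) })
            (λ u → case to g u of λ { (inj₁ s) → inj₁ (from e s) ; (inj₂ t) → inj₂ (from f t) })
      Sat-normalForm ρ (φ ⇒′ ψ)   =
        let e = Sat-normalForm ρ φ ; f = Sat-normalForm ρ ψ
            g = Sat-++ K ρ (¬ᵈ (normalForm φ)) (normalForm ψ)
            h = Sat-¬ᵈ K ρ (normalForm φ) in
        mk⇔ (λ s → case em of λ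
              { (yes t) → from g (inj₂ (to f (s t)))
              ; (no ¬t) → from g (inj₁ (from h (¬t ∘ from e))) })
            (λ u t → case to g u of λ
              { (inj₁ ¬t) → contradiction (to e t) (to h ¬t)
              ; (inj₂ s)  → from f s })
      Sat-normalForm ρ (∃′ φ)     =
        let g = Sat-∃ᵈ ρ (normalForm φ) in
        mk⇔ (λ (y , s) → from g (y , to (Sat-normalForm (y ∷ᵛ ρ) φ) s))
            (λ u → let y , s = to g u in y , from (Sat-normalForm (y ∷ᵛ ρ) φ) s)
      Sat-normalForm ρ (∀′ φ)     =
        let D = ¬ᵈ (normalForm φ)
            g = Sat-∃ᵈ ρ D
            h = Sat-¬ᵈ K ρ (List.map ∃ᶜ D) in
        mk⇔ (λ s → from h λ u → let y , t = to g u in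
              to (Sat-¬ᵈ K (y ∷ᵛ ρ) (normalForm φ)) t (to (Sat-normalForm (y ∷ᵛ ρ) φ) (s y)))
            (λ u y → stable λ ¬s → to h u (from g (y ,
              from (Sat-¬ᵈ K (y ∷ᵛ ρ) (normalForm φ)) (¬s ∘ from (Sat-normalForm (y ∷ᵛ ρ) φ)))))

  -- The Fréchet filter

  fréchet : ∀ ℓ → Filter (Lift ℓ ℕ)
  fréchet ℓ = record
    { Mem    = λ P → ∃[ k ] ∀ n → k ≤ n → P (lift n)
    ; full   = 0 , λ _ _ → tt
    ; upward = λ f (k , p) → k , λ n k≤n → f (p n k≤n)
    ; inter  = λ (k , p) (l , q) → k ⊔ l , λ n k⊔l≤n →
        p n (≤-trans (m≤m⊔n k l) k⊔l≤n) , q n (≤-trans (m≤n⊔m k l) k⊔l≤n)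
    ; proper = λ (k , p) → Empty.⊥-elim (p k ≤-refl)
    }

  module _ (P : Pred (Lift ℓ ℕ) ℓ) where
    open Filter (fréchet ℓ)

    -- The parity of the number of elements of ∁ P below n, so that consecutive
    -- elements of ∁ P have different parities.
    parity : ℕ → Bool
    parity zero    = false
    parity (suc n) = ifᵈ (P (lift n)) (parity n) (not (parity n))

    -- The parity flips only at elements of `∁ P`, and from `k` on none occurs while the parity is
    -- `b`.
    parity-const : ∀ b k → (∀ n → k ≤ n → parity n ≡ b → P (lift n)) →
                   parity k ≡ b → ∀ {n} → k ≤′ n → parity n ≡ b
    parity-const b k h e ≤′-refl       = e
    parity-const b k h e (≤′-step k≤n) =
      let e′ = parity-const b k h e k≤n in trans (ifᵈ-yes (h _ (≤′⇒≤ k≤n) e′)) e′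

    -- If parity `b` occurs late enough, it persists and `P` holds from there on. If it never does,
    -- a late element of `∁ P` would flip the parity to `b`.
    mem-parity : ∀ b → Mem (λ i → parity (lower i) ≡ b → P i) → Mem P
    mem-parity b (k , h) with em {P = ∃[ n ] k ≤ n × parity n ≡ b}
    ... | yes (m , k≤m , e) = m , λ n m≤n → h n (≤-trans k≤m m≤n)
            (parity-const b m (λ n m≤n → h n (≤-trans k≤m m≤n)) e (≤⇒≤′ m≤n))
    ... | no ¬e = k , λ n k≤n → stable λ ¬p → ¬e (suc n , ≤-trans k≤n (n≤1+n n) ,
            trans (ifᵈ-no ¬p) (sym (¬-not λ e → ¬e (n , k≤n , sym e))))

  fréchet-atomless : Atomless (fréchet ℓ)
  fréchet-atomless P ¬p =
    (λ i → Lift _ (parity P (lower i) ≡ true)) ,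
    (λ m → ¬p (mem-parity P true (upward (λ f e → f (lift e)) m))) ,
    (λ m → ¬p (mem-parity P false (upward (λ f e → f λ (lift e′) → not-¬ e e′) m)))
    where open Filter (fréchet _)

  -- Axiomatization by Palyutin consequences

  module _ {L : Signature ℓ} where

    infix 4 _≡ᵖ_
    _≡ᵖ_ : Structure L → Structure L → Set ℓ
    M ≡ᵖ N = {φ : Sentence L} → Palyutin φ → Sat M []ᵛ φ ⇔ Sat N []ᵛ φ

    ≡ᵖ-power : (M N : Structure L) → M ≡ᵖ N →
               reducedPower M (fréchet ℓ) ≡ᵖ reducedPower N (fréchet ℓ)
    ≡ᵖ-power M N e p =
      ⇔-sym (Łoś-power N (fréchet ℓ) p) ⇔-∘ (e p ⇔-∘ Łoś-power M (fréchet ℓ) p)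

    -- Both powers evaluate the same normal form, whose Palyutin constituents have equal truth
    -- values in them.
    power-elementary : (M N : Structure L) → M ≡ᵖ N → (φ : Sentence L) →
      Sat (reducedPower M (fréchet ℓ)) []ᵛ φ → Sat (reducedPower N (fréchet ℓ)) []ᵛ φ
    power-elementary M N e φ s =
      from (Sat-normalForm (fréchet ℓ) fréchet-atomless (const N) []ᵛ φ)
        (Any.map (λ { {(θ , p) , ψs} (t , ¬us) →
            to (≡ᵖ-power M N e p) t ,
            All.map (λ { {ψ , q} ¬u → ¬u ∘ from (≡ᵖ-power M N e q) }) ¬us })
          (to (Sat-normalForm (fréchet ℓ) fréchet-atomless (const M) []ᵛ φ) s))

    module _ (T : Theory L) where

      PalyutinConsequence : Theory L
      PalyutinConsequence φ = Palyutin φ × Resize ℓ (∀ M → M ⊨ T → Sat M []ᵛ φ)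

      axiomatizable : PreservedUnderReducedProducts T → PreservedUnderReducedRoots T →
                      PreservedUnderFiniteCartesianFactors T → PalyutinAxiomatizable T
      axiomatizable products roots factors =
        PalyutinConsequence , (λ _ → proj₁) ,
        λ N → mk⇔ (λ t φ (_ , c) → unresize c N t) (model N)
        where
        module _ (N : Structure L) (N⊨ : N ⊨ PalyutinConsequence) where

          Refuted : Set ℓ
          Refuted = Σ[ φ ∈ Sentence L ] Palyutin φ × ¬ Sat N []ᵛ φ

          -- Otherwise `φ` would be a Palyutin consequence of `T` and hold in `N`.
          refuting : (r : Refuted) → Σ[ M ∈ Structure L ] M ⊨ T × ¬ Sat M []ᵛ (proj₁ r)
          refuting (φ , p , ¬s) = stable λ ¬e → ¬s (N⊨ φ (p , resize λ M t →
            stable λ ¬s → ¬e (M , t , ¬s)))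

          -- Inhabits the index set of the product `M`, as properness of its filter requires.
          ⊥-refuted : Refuted
          ⊥-refuted = ⊥′ , ⊥ᵖ , λ ()

          models : Refuted → Structure L
          models = proj₁ ∘ refuting

          M : Structure L
          M = reducedProduct models (trivialFilter ⊥-refuted)

          M⊨T : M ⊨ T
          M⊨T = products _ models (trivialFilter ⊥-refuted) (proj₁ ∘ proj₂ ∘ refuting)

          -- A Palyutin sentence false in `N` fails in the factor of `M` indexed by it, hence in
          -- `M`.
          M⇒N : {φ : Sentence L} → Palyutin φ → Sat M []ᵛ φ → Sat N []ᵛ φ
          M⇒N p s = stable λ ¬s → proj₂ (proj₂ (refuting (_ , p , ¬s)))
            (to (Łoś-sentence models (trivialFilter ⊥-refuted) p) s (_ , p , ¬s))

          pair : Lift ℓ (Fin 2) → Structure L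
          pair (lift zero)    = M
          pair (lift (suc _)) = N

          M×N : Structure L
          M×N = reducedProduct pair (trivialFilter (lift zero))

          -- A Palyutin sentence holds in the product exactly when it holds in both factors, and
          -- `M⇒N` carries it from `M` to `N`.
          M≡ᵖM×N : M ≡ᵖ M×N
          M≡ᵖM×N p = mk⇔
            (λ s → from (Łoś-sentence pair (trivialFilter (lift zero)) p)
              λ { (lift zero) → s ; (lift (suc _)) → M⇒N p s })
            (λ s → to (Łoś-sentence pair (trivialFilter (lift zero)) p) s (lift zero))

          M×N⊨T : M×N ⊨ T
          M×N⊨T = roots M×N _ (fréchet ℓ) λ φ φ∈T →
            power-elementary M M×N M≡ᵖM×N φ
              (products _ (const M) (fréchet ℓ) (0 , λ _ _ → M⊨T) φ φ∈T)

          model : N ⊨ T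
          model = factors _ (2 , mk↔ₛ′ lower lift (λ _ → refl) (λ _ → refl)) pair
            (from (product-⊨ pair (lift zero) T) M×N⊨T) (lift (suc zero))

      -- From Palyutin axioms to preservation

      module _ (axioms : PalyutinAxiomatizable T) where

        private
          Γ      = proj₁ axioms
          pal    = proj₁ (proj₂ axioms)
          T⇔Γ    = proj₂ (proj₂ axioms)

        axiomatizable⇒products : PreservedUnderReducedProducts T
        axiomatizable⇒products I M F m = from (T⇔Γ _) λ φ φ∈Γ →
          from (Łoś-sentence M F (pal φ φ∈Γ)) (upward (λ {i} t → to (T⇔Γ (M i)) t φ φ∈Γ) m)
          where open Filter F

        axiomatizable⇒roots : PreservedUnderReducedRoots T
        axiomatizable⇒roots M I F t = from (T⇔Γ M) λ φ φ∈Γ →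
          to (Łoś-power M F (pal φ φ∈Γ)) (to (T⇔Γ _) t φ φ∈Γ)

        axiomatizable⇒factors : PreservedUnderCartesianFactors T
        axiomatizable⇒factors I M t i = from (T⇔Γ (M i)) λ φ φ∈Γ →
          to (Łoś-sentence M (trivialFilter i) (pal φ φ∈Γ))
             (to (T⇔Γ _) (to (product-⊨ M i T) t) φ φ∈Γ) i

corollary1p17 : (∀ {a} → ExcludedMiddle a) → (∀ {a b} → Extensionality a b) →
    ∀ {ℓ} (L : Signature ℓ) (T : Theory L) → Consistent T →
    ((PreservedUnderReducedProducts T × PreservedUnderReducedRoots T × PreservedUnderCartesianFactors T)
    ⇔ PalyutinAxiomatizable T)
    × ((PreservedUnderReducedProducts T × PreservedUnderReducedRoots T × PreservedUnderFiniteCartesianFactors T)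
    ⇔ PalyutinAxiomatizable T)
corollary1p17 em ext L T _ =
    mk⇔ (λ (products , roots , factors) → axiomatizable T products roots λ I _ → factors I)
        (λ ax → axiomatizable⇒products T ax , axiomatizable⇒roots T ax , axiomatizable⇒factors T ax)
  , mk⇔ (λ (products , roots , factors) → axiomatizable T products roots factors)
        (λ ax → axiomatizable⇒products T ax , axiomatizable⇒roots T ax ,
                λ I _ → axiomatizable⇒factors T ax I)
  where open Classical em ext
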